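{- The pigeonhole formulas $\mathrm{PHP}^{n+1}_n$ ($n\ge 1$) have Circular Resolution refutations of length polynomial in $n$; that is, there is a polynomial $p$ such that for every $n\ge 1$ there is a Circular Resolution refutation of $\mathrm{PHP}^{n+1}_n$ of length at most $p(n)$.
   Context: Pigeonhole formula. $\mathrm{PHP}^{n+1}_n$ is the CNF formula with variables $X_{u,v}$ for $u\in\{1,\dots,n+1\}$ and $v\in\{1,\dots,n\}$ and clauses: $X_{u,1}\vee\cdots\vee X_{u,n}$ for each $u$; and $\overline{X_{u_1,v}}\vee\overline{X_{u_2,v}}$ for all $u_1\neq u_2$ and all $v$. Circular Resolution. A literal is a propositional variable $X$ or its negation $\overline{X}$. A clause is a finite set of literals read as a disjunction; $0$ denotes the empty clause. The rules are, for clauses $C$ and variables $X$: axiom (no premises, conclusion $X\vee\overline{X}$); symmetric cut (premises $C\vee X$ and $C\vee\overline{X}$, conclusion $C$); split (premise $C$, two conclusions $C\vee X$ and $C\vee\overline{X}$). A circular pre-proof $\Pi$ is a finite directed bipartite graph with formula-vertices (set $J$), each labelled by a clause (labels may repeat), and inference-vertices (set $I$), each labelled by an instance of a rule whose premises are the labels of its in-neighbours and whose conclusions are the labels of its out-neighbours (one in-neighbour per premise, one out-neighbour per conclusion); cycles are allowed. A flow assignment is a map $F:I\to\mathbb{R}^+$ to the positive reals; the balance of $u\in J$ is $B(u)=\sum_{w\in N^-(u)}F(w)-\sum_{w\in N^+(u)}F(w)$, where $N^-(u),N^+(u)$ are the sets of in- and out-neighbours of $u$. Sources are the formula-vertices of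 negative balance, sinks those of positive balance. $\Pi$ is a Circular Resolution proof of a clause $A$ from a set of clauses $\mathscr{H}$ if there is a flow assignment for which every source is labelled by a clause in $\mathscr{H}$ and some sink is labelled by $A$. A refutation of $\mathscr{H}$ is a proof of the empty clause $0$ from $\mathscr{H}$. The length of the proof is its number of vertices. -}

module Defs where

open import Data.Fin.Base using (Fin)
open import Data.Fin.Subset using (Subset) renaming (_∈_ to _∈ₛ_)
open import Data.Fin.Subset.Properties using (_∈?_)
open import Data.List.Base using (List; []; _∷_; map; foldr; filter; allFin)
open import Data.List.Membership.Propositional using (_∈_)
open import Data.List.Relation.Binary.BagAndSetEquality using (_∼[_]_; set)
open import Data.List.Relation.Binary.Pointwise using (Pointwise)
open import Data.List.Relation.Unary.Unique.Propositional using (Unique)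
open import Data.Nat.Base as ℕ using (ℕ; suc)
import Data.Nat.Properties as ℕ
open import Data.Product.Base using (Σ-syntax; ∃-syntax; _×_; _,_; proj₁)
open import Data.Rational.Base as ℚ using (ℚ; 0ℚ; ½)
import Data.Rational.Properties as ℚ
import Data.Rational.Solver as ℚ
open import Function.Base using (_∘_)
open import Function.Bundles using (_⇔_)
open import Level using (0ℓ)
open import Relation.Binary.PropositionalEquality
  using (_≡_; _≢_; refl; sym; trans; cong; subst)
open import Relation.Unary using (Pred)

-- A real is represented by a Cauchy sequence of rationals. Different
-- sequences may represent the same real; _<ᵣ_ does not distinguish them.

IsCauchy : (ℕ → ℚ) → Set
IsCauchy x = ∀ ε → 0ℚ ℚ.< ε →
  ∃[ N ] (∀ m n → N ℕ.≤ m → N ℕ.≤ n → ℚ.∣ x m ℚ.- x n ∣ ℚ.< ε)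

record ℝ : Set where
  constructor mkℝ
  field
    seq    : ℕ → ℚ
    cauchy : IsCauchy seq

open ℝ public

infix  4 _<ᵣ_
infixl 6 _+ᵣ_ _-ᵣ_
infix  8 -ᵣ_

_<ᵣ_ : ℝ → ℝ → Set
x <ᵣ y = ∃[ ε ] 0ℚ ℚ.< ε ×
  ∃[ N ] (∀ n → N ℕ.≤ n → seq x n ℚ.+ ε ℚ.< seq y n)

fromℚ : ℚ → ℝ
fromℚ q = mkℝ (λ _ → q) λ ε ε>0 → 0 , λ _ _ _ _ →
  subst (ℚ._< ε) (sym (cong ℚ.∣_∣ (ℚ.+-inverseʳ q))) ε>0

0ᵣ : ℝ
0ᵣ = fromℚ 0ℚ

private
  open ℚ.+-*-Solver using (solve; _:+_; _:-_; :-_; _:=_)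

  +-interchange-- : ∀ a b c d →
    (a ℚ.+ b) ℚ.- (c ℚ.+ d) ≡ (a ℚ.- c) ℚ.+ (b ℚ.- d)
  +-interchange-- = solve 4
    (λ a b c d → (a :+ b) :- (c :+ d) := (a :- c) :+ (b :- d)) refl

  neg-- : ∀ a b → (ℚ.- a) ℚ.- (ℚ.- b) ≡ ℚ.- (a ℚ.- b)
  neg-- = solve 2 (λ a b → (:- a) :- (:- b) := :- (a :- b)) refl

  ½*ε+½*ε≡ε : ∀ ε → ½ ℚ.* ε ℚ.+ ½ ℚ.* ε ≡ ε
  ½*ε+½*ε≡ε ε =
    trans (sym (ℚ.*-distribʳ-+ ε ½ ½)) (ℚ.*-identityˡ ε)

  0<½*ε : ∀ ε → 0ℚ ℚ.< ε → 0ℚ ℚ.< ½ ℚ.* ε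
  0<½*ε ε ε>0 = ℚ.positive⁻¹ (½ ℚ.* ε) {{ℚ.pos*pos⇒pos ½ ε {{ℚ.positive ε>0}}}}

_+ᵣ_ : ℝ → ℝ → ℝ
seq    (x +ᵣ y) n = seq x n ℚ.+ seq y n
cauchy (x +ᵣ y) ε ε>0
  with cauchy x (½ ℚ.* ε) (0<½*ε ε ε>0) | cauchy y (½ ℚ.* ε) (0<½*ε ε ε>0)
... | M , hx | N , hy = M ℕ.⊔ N , λ m n ≤m ≤n →
  let open ℚ.≤-Reasoning
      a = seq x m
      b = seq y m
      c = seq x n
      d = seq y n
  in begin-strict
    ℚ.∣ (a ℚ.+ b) ℚ.- (c ℚ.+ d) ∣        ≡⟨ cong ℚ.∣_∣ (+-interchange-- a b c d) ⟩
    ℚ.∣ (a ℚ.- c) ℚ.+ (b ℚ.- d) ∣        ≤⟨ ℚ.∣p+q∣≤∣p∣+∣q∣ (a ℚ.- c) (b ℚ.- d) ⟩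
    ℚ.∣ a ℚ.- c ∣ ℚ.+ ℚ.∣ b ℚ.- d ∣      <⟨ ℚ.+-mono-<
                                              (hx m n (ℕ.m⊔n≤o⇒m≤o M N ≤m) (ℕ.m⊔n≤o⇒m≤o M N ≤n))
                                              (hy m n (ℕ.m⊔n≤o⇒n≤o M N ≤m) (ℕ.m⊔n≤o⇒n≤o M N ≤n)) ⟩
    ½ ℚ.* ε ℚ.+ ½ ℚ.* ε                  ≡⟨ ½*ε+½*ε≡ε ε ⟩
    ε                                    ∎

-ᵣ_ : ℝ → ℝ
seq    (-ᵣ x) n = ℚ.- seq x n
cauchy (-ᵣ x) ε ε>0 with cauchy x ε ε>0
... | N , h = N , λ m n ≤m ≤n →
  subst (ℚ._< ε)
    (sym (trans (cong ℚ.∣_∣ (neg-- (seq x m) (seq x n)))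
                (ℚ.∣-p∣≡∣p∣ (seq x m ℚ.- seq x n))))
    (h m n ≤m ≤n)

_-ᵣ_ : ℝ → ℝ → ℝ
x -ᵣ y = x +ᵣ (-ᵣ y)

sumᵣ : List ℝ → ℝ
sumᵣ = foldr _+ᵣ_ 0ᵣ

ℝ⁺ : Set
ℝ⁺ = Σ[ x ∈ ℝ ] 0ᵣ <ᵣ x

data Literal (V : Set) : Set where
  pos neg : V → Literal V

-- A finite set of literals is given by a list; clauses are only ever
-- compared with _≈_, which ignores order and repetitions.

Clause : Set → Set
Clause V = List (Literal V)

infix 4 _≈_ _∈ᶜ_
infixl 5 _∨_

_≈_ : ∀ {V} → Clause V → Clause V → Set
C ≈ D = C ∼[ set ] D

_∨_ : ∀ {V} → Clause V → Literal V → Clause V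
C ∨ l = l ∷ C

𝟘 : ∀ {V} → Clause V
𝟘 = []

ClauseSet : Set → Set₁
ClauseSet V = Pred (Clause V) 0ℓ

_∈ᶜ_ : ∀ {V} → Clause V → ClauseSet V → Set
C ∈ᶜ ℋ = ∃[ D ] ℋ D × C ≈ D

data RuleInstance (V : Set) : Set where
  axiom : V → RuleInstance V
  cut   : Clause V → V → RuleInstance V
  split : Clause V → V → RuleInstance V

premises : ∀ {V} → RuleInstance V → List (Clause V)
premises (axiom X)   = []
premises (cut C X)   = (C ∨ pos X) ∷ (C ∨ neg X) ∷ []
premises (split C X) = C ∷ []

conclusions : ∀ {V} → RuleInstance V → List (Clause V)
conclusions (axiom X)   = (𝟘 ∨ pos X ∨ neg X) ∷ []
conclusions (cut C X)   = C ∷ []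
conclusions (split C X) = (C ∨ pos X) ∷ (C ∨ neg X) ∷ []

-- The vertices in S are in bijection with the list Cs, each vertex being
-- labelled by the clause it corresponds to.

Matches : ∀ {V k} → (Fin k → Clause V) → Subset k → List (Clause V) → Set
Matches {k = k} label S Cs = Σ[ us ∈ List (Fin k) ]
  Unique us × (∀ u → u ∈ₛ S ⇔ u ∈ us) × Pointwise (λ u C → label u ≈ C) us Cs

record PreProof (V : Set) : Set where
  field
    #J #I : ℕ

  J = Fin #J
  I = Fin #I

  -- The edges of the bipartite graph are given by the in- and
  -- out-neighbourhoods of the inference-vertices.
  field
    inNbrs outNbrs : I → Subset #J
    label          : J → Clause V
    rule           : I → RuleInstance V
    inMatches      : ∀ w → Matches label (inNbrs w) (premises (rule w))
    outMatches     : ∀ w → Matches label (outNbrs w) (conclusions (rule w))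

  N⁻ N⁺ : J → List I
  N⁻ u = filter (λ w → u ∈? outNbrs w) (allFin #I)
  N⁺ u = filter (λ w → u ∈? inNbrs w) (allFin #I)

  FlowAssignment : Set
  FlowAssignment = I → ℝ⁺

  balance : FlowAssignment → J → ℝ
  balance F u = sumᵣ (map (proj₁ ∘ F) (N⁻ u)) -ᵣ sumᵣ (map (proj₁ ∘ F) (N⁺ u))

  IsSource IsSink : FlowAssignment → J → Set
  IsSource F u = balance F u <ᵣ 0ᵣ
  IsSink   F u = 0ᵣ <ᵣ balance F u

  proofLength : ℕ
  proofLength = #J ℕ.+ #I

open PreProof public using (proofLength)

IsProof : ∀ {V} → PreProof V → ClauseSet V → Clause V → Set
IsProof Π ℋ A = Σ[ F ∈ FlowAssignment ]
    (∀ u → IsSource F u → label u ∈ᶜ ℋ)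
  × (∃[ u ] IsSink F u × label u ≈ A)
  where open PreProof Π

IsRefutation : ∀ {V} → PreProof V → ClauseSet V → Set
IsRefutation Π ℋ = IsProof Π ℋ 𝟘

data PHPVar (n : ℕ) : Set where
  X : Fin (suc n) → Fin n → PHPVar n

data PHP (n : ℕ) : ClauseSet (PHPVar n) where
  pigeon : ∀ u → PHP n (map (λ v → pos (X u v)) (allFin n))
  hole   : ∀ {u₁ u₂} → u₁ ≢ u₂ → ∀ v →
           PHP n (𝟘 ∨ neg (X u₁ v) ∨ neg (X u₂ v))

-- A polynomial is the list of its coefficients, constant term first.

Polynomial : Set
Polynomial = List ℕ

eval : Polynomial → ℕ → ℕ
eval p n = foldr (λ a r → a ℕ.+ n ℕ.* r) 0 p

{-# OPTIONS --safe #-}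
module Submission where

-- A cut and a split are inverse to each other, and a clause weighs as much as
-- its two extensions by x and ¬ x. Splitting 0 along the variables of a hole
-- yields, for each pigeon u, the clause saying that u is not the last pigeon in
-- that hole; the hole axioms turn these into the unit clauses ¬ X u v. Splitting
-- the latter along the pigeon u says that v is not its last hole, and the pigeon
-- axiom for u cuts all of these back to 0. So n copies of 0, one per hole, become
-- n + 1 copies of 0, one per pigeon, each rule instance being used with flow 1.

open import Defs
open import Data.Nat.Base using (ℕ; _≤_)
open import Data.Product.Base using (Σ-syntax; _×_)

open import Data.Bool.Base using (true)
open import Data.Fin.Base as Fin using (Fin)
import Data.Fin.Properties as Fin
open import Data.Fin.Subset using (Subset) renaming (_∈_ to _∈ₛ_)
open import Data.List.Base
  using (List; []; _∷_; [_]; _++_; map; concatMap; filter; length; lookup; replicate; deduplicate; allFin)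
open import Data.List.Properties
  using (≡-dec; filter-++; length-++; length-map; length-tabulate; map-∘; filter-accept; filter-reject;
         ∷-injectiveˡ; ++-cancelˡ; concatMap-cong; filter-≐; length-deduplicate; map-tabulate;
         tabulate-lookup)
import Data.List.Membership.DecPropositional as DecMembership
open import Data.List.Membership.Propositional using (_∈_)
open import Data.List.Membership.Propositional.Properties
  using (∈-++⁺ˡ; ∈-++⁺ʳ; ∈-concatMap⁺; ∈-deduplicate⁺; ∈-lookup; ∈-map⁺; ∈-map⁻)
open import Data.List.Relation.Binary.BagAndSetEquality using (bag-=⇒; ↭⇒∼bag)
open import Data.List.Relation.Binary.Permutation.Propositional as ↭ using (_↭_; prep)
open import Data.List.Relation.Binary.Permutation.Propositional.Properties
  using (filter-↭; ↭-length; shift; shifts; ++⁺ˡ; ++-comm)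
open import Data.List.Relation.Binary.Pointwise using (Pointwise; []; _∷_)
open import Data.List.Relation.Unary.All as All using (All; []; _∷_)
open import Data.List.Relation.Unary.AllPairs as AllPairs using (AllPairs; []; _∷_)
import Data.List.Relation.Unary.AllPairs.Properties as AllPairsₚ
open import Data.List.Relation.Unary.Any as Any using (Any; here; there; index)
open import Data.List.Relation.Unary.Any.Properties using (lookup-index)
open import Data.List.Relation.Unary.Unique.Propositional using (Unique)
open import Data.List.Relation.Unary.Unique.Propositional.Properties
  using (allFin⁺; Unique[x∷xs]⇒x∉xs) renaming (map⁻ to Unique-map⁻)
import Data.List.Relation.Unary.Unique.DecPropositional.Properties as UniqueDec
open import Data.Nat.Base using (suc; _+_; _*_; _<_; z≤n; s≤s)
open import Data.Nat.Properties
open import Data.Nat.Solver using (module +-*-Solver)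
open import Data.Product.Base using (_,_)
open import Data.Rational.Base as ℚ using (ℚ; 0ℚ; 1ℚ; ½)
import Data.Rational.Properties as ℚ
open import Data.Sum.Base using (_⊎_; inj₁; inj₂)
import Data.Vec.Base as Vec
import Data.Vec.Properties as Vec
open import Function.Base using (_∘_; _∋_; id)
open import Function.Bundles using (_⇔_; mk⇔; module Equivalence)
open import Level using (0ℓ)
open import Relation.Binary.Definitions using (DecidableEquality)
open import Relation.Binary.PropositionalEquality
  using (_≡_; _≢_; refl; sym; trans; cong; cong₂; subst; subst₂; module ≡-Reasoning)
open import Relation.Nullary.Decidable using (yes; no; does; map′; toWitness; dec-true)
open import Relation.Nullary.Negation using (¬_; contradiction)
open import Relation.Unary using (Pred; Decidable)

open +-*-Solver using (solve; _:+_; _:*_; _:=_; con)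

-- Counting and permuting lists

lookup-injective : ∀ {A : Set} {xs : List A} → Unique xs → ∀ i j → lookup xs i ≡ lookup xs j → i ≡ j
lookup-injective (x∉ ∷ u) Fin.zero    Fin.zero    eq = refl
lookup-injective (x∉ ∷ u) Fin.zero    (Fin.suc j) eq = contradiction eq (All.lookup x∉ (∈-lookup j))
lookup-injective (x∉ ∷ u) (Fin.suc i) Fin.zero    eq = contradiction (sym eq) (All.lookup x∉ (∈-lookup i))
lookup-injective (x∉ ∷ u) (Fin.suc i) (Fin.suc j) eq = cong Fin.suc (lookup-injective u i j eq)

length-filter-map : ∀ {A B : Set} {Q : Pred B 0ℓ} (Q? : Decidable Q) (f : A → B) xs →
                    length (filter (λ x → Q? (f x)) xs) ≡ length (filter Q? (map f xs))
length-filter-map Q? f []       = refl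
length-filter-map Q? f (x ∷ xs) with Q? (f x)
... | yes _ = cong suc (length-filter-map Q? f xs)
... | no _  = length-filter-map Q? f xs

-- Converts degrees in the graph, which count indices of inference-vertices, into counts over the
-- list of steps itself.
length-filter-allFin : ∀ {A : Set} (xs : List A) {P : Pred (Fin (length xs)) 0ℓ} {Q : Pred A 0ℓ}
  (P? : Decidable P) (Q? : Decidable Q) → (∀ i → P i ⇔ Q (lookup xs i)) →
  length (filter P? (allFin (length xs))) ≡ length (filter Q? xs)
length-filter-allFin xs P? Q? P⇔Q = begin
  length (filter P? (allFin (length xs)))
    ≡⟨ cong length (filter-≐ P? (Q? ∘ lookup xs)
         ((λ {i} → Equivalence.to (P⇔Q i)) , (λ {i} → Equivalence.from (P⇔Q i))) (allFin (length xs))) ⟩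
  length (filter (Q? ∘ lookup xs) (allFin (length xs)))
    ≡⟨ length-filter-map Q? (lookup xs) (allFin (length xs)) ⟩
  length (filter Q? (map (lookup xs) (allFin (length xs))))
    ≡⟨ cong (length ∘ filter Q?) (trans (map-tabulate id (lookup xs)) (tabulate-lookup xs)) ⟩
  length (filter Q? xs)
    ∎
  where open ≡-Reasoning

interleave-↭ : ∀ {A B : Set} (h : A → B) (g : A → List B) xs →
               map h xs ++ concatMap g xs ↭ concatMap (λ x → h x ∷ g x) xs
interleave-↭ h g []       = ↭.refl
interleave-↭ h g (x ∷ xs) =
  prep (h x) (↭.trans (shifts (map h xs) (g x)) (++⁺ˡ (g x) (interleave-↭ h g xs)))

-- Reading a matrix by rows or by columns lists the same entries; this is how clauses grouped by
-- hole get regrouped by pigeon.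
transpose-↭ : ∀ {A B C : Set} (f : A → B → C) xs ys →
              concatMap (λ x → map (f x) ys) xs ↭ concatMap (λ y → map (λ x → f x y) xs) ys
transpose-↭ f []       ys = go ys
  where
  go : ∀ ys → [] ↭ concatMap (λ _ → []) ys
  go []       = ↭.refl
  go (y ∷ ys) = go ys
transpose-↭ f (x ∷ xs) ys =
  ↭.trans (++⁺ˡ (map (f x) ys) (transpose-↭ f xs ys)) (interleave-↭ (f x) _ ys)

concatMap-[-] : ∀ {A B : Set} (b : B) (xs : List A) → concatMap (λ _ → [ b ]) xs ≡ replicate (length xs) b
concatMap-[-] b []       = refl
concatMap-[-] b (x ∷ xs) = cong (b ∷_) (concatMap-[-] b xs)

-- Real balances under the flow that is constantly 1

0<½ : 0ℚ ℚ.< ½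
0<½ = toWitness {a? = 0ℚ ℚ.<? ½} _

0+½<1 : 0ℚ ℚ.+ ½ ℚ.< 1ℚ
0+½<1 = toWitness {a? = (0ℚ ℚ.+ ½) ℚ.<? 1ℚ} _

unit⁺ : ℝ⁺
unit⁺ = fromℚ 1ℚ , ½ , 0<½ , 0 , λ _ _ → 0+½<1

-- The embedding of the naturals, built by repeated addition of 1 so that it unfolds exactly like a
-- sum of unit flows.
ι : ℕ → ℚ
ι 0       = 0ℚ
ι (suc k) = 1ℚ ℚ.+ ι k

0≤ι : ∀ k → 0ℚ ℚ.≤ ι k
0≤ι 0       = ℚ.≤-refl
0≤ι (suc k) = ℚ.+-mono-≤ (toWitness {a? = 0ℚ ℚ.≤? 1ℚ} _) (0≤ι k)

ι-mono-≤ : ∀ {k l} → k ≤ l → ι k ℚ.≤ ι l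
ι-mono-≤ {l = l} z≤n = 0≤ι l
ι-mono-≤ (s≤s k≤l)   = ℚ.+-monoʳ-≤ 1ℚ (ι-mono-≤ k≤l)

seq-sum-units : ∀ {A : Set} (xs : List A) i → seq (sumᵣ (map (λ _ → fromℚ 1ℚ) xs)) i ≡ ι (length xs)
seq-sum-units []       i = refl
seq-sum-units (x ∷ xs) i = cong (1ℚ ℚ.+_) (seq-sum-units xs i)

module UnitFlow {V : Set} (Π : PreProof V) where
  open PreProof Π

  unitFlow : FlowAssignment
  unitFlow _ = unit⁺

  seq-balance : ∀ u i → seq (balance unitFlow u) i ≡ ι (length (N⁻ u)) ℚ.- ι (length (N⁺ u))
  seq-balance u i = cong₂ ℚ._-_ (seq-sum-units (N⁻ u) i) (seq-sum-units (N⁺ u) i)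

  -- Every term of the sequence for the balance is the same difference of degrees, so a single index
  -- refutes negativity.
  not-source : ∀ u → length (N⁺ u) ≤ length (N⁻ u) → ¬ IsSource unitFlow u
  not-source u out≤in (ε , ε>0 , M , below) = ℚ.<-irrefl refl (begin-strict
    0ℚ                                ≡⟨ ℚ.+-inverseʳ (ι out) ⟨
    ι out ℚ.- ι out                   ≤⟨ ℚ.+-monoˡ-≤ (ℚ.- ι out) (ι-mono-≤ out≤in) ⟩
    ι (length (N⁻ u)) ℚ.- ι out       ≡⟨ seq-balance u M ⟨
    bal                               ≡⟨ ℚ.+-identityʳ bal ⟨
    bal ℚ.+ 0ℚ                        <⟨ ℚ.+-monoʳ-< bal ε>0 ⟩
    bal ℚ.+ ε                         <⟨ below M ≤-refl ⟩
    0ℚ                                ∎)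
    where
    open ℚ.≤-Reasoning
    out = length (N⁺ u)
    bal = seq (balance unitFlow u) M

  sink : ∀ u → length (N⁺ u) < length (N⁻ u) → IsSink unitFlow u
  -- Degrees are integers, so a positive balance is at least 1, and ½ is a rational gap strictly
  -- below it.
  sink u out<in = ½ , 0<½ , 0 , λ i _ → begin-strict
    0ℚ ℚ.+ ½                                  <⟨ 0+½<1 ⟩
    1ℚ                                        ≡⟨ ℚ.+-identityʳ 1ℚ ⟨
    1ℚ ℚ.+ 0ℚ                                 ≡⟨ cong (1ℚ ℚ.+_) (ℚ.+-inverseʳ (ι out)) ⟨
    1ℚ ℚ.+ (ι out ℚ.- ι out)                  ≡⟨ ℚ.+-assoc 1ℚ (ι out) (ℚ.- ι out) ⟨
    ι (suc out) ℚ.- ι out                     ≤⟨ ℚ.+-monoˡ-≤ (ℚ.- ι out) (ι-mono-≤ out<in) ⟩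
    ι (length (N⁻ u)) ℚ.- ι out               ≡⟨ seq-balance u i ⟨
    seq (balance unitFlow u) i                ∎
    where
    open ℚ.≤-Reasoning
    out = length (N⁺ u)

-- This and the next lemma close the cost recursions below: the head of a list is paid for
-- separately from its `m` remaining variables.
m+m²≤[1+m]² : ∀ m → m + m * m ≤ suc m * suc m
m+m²≤[1+m]² m = ≤-trans (m≤m+n _ (suc m)) (≤-reflexive
  (solve 1 (λ m → (m :+ m :* m) :+ (con 1 :+ m) := (con 1 :+ m) :* (con 1 :+ m)) refl m))

m²+m+m³≤[1+m]³ : ∀ m → (m * m + m) + m * (m * m) ≤ suc m * (suc m * suc m)
m²+m+m³≤[1+m]³ m = ≤-trans (m≤m+n _ (suc (2 * (m * m) + 2 * m))) (≤-reflexive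
  (solve 1 (λ m → ((m :* m :+ m) :+ m :* (m :* m)) :+ (con 1 :+ (con 2 :* (m :* m) :+ con 2 :* m))
                  := (con 1 :+ m) :* ((con 1 :+ m) :* (con 1 :+ m))) refl m))

-- Cut and split steps on list clauses

-- Clauses are treated as lists here; the literals P in front of the pivot x
-- make it unnecessary to reorder them.
data Step (V : Set) : Set where
  cut split : (P C : Clause V) (x : V) → Step V

module _ {V : Set} where

  halves : (P C : Clause V) (x : V) → List (Clause V)
  halves P C x = (P ++ pos x ∷ C) ∷ (P ++ neg x ∷ C) ∷ []

  ins outs : Step V → List (Clause V)
  ins (cut P C x)    = halves P C x
  ins (split P C x)  = [ P ++ C ]
  outs (cut P C x)   = [ P ++ C ]
  outs (split P C x) = halves P C x

  halves-unique : ∀ P C x → Unique (halves P C x)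
  halves-unique P C x = ((λ eq → pos≢neg (∷-injectiveˡ (++-cancelˡ P _ _ eq))) ∷ []) ∷ [] ∷ []
    where
    pos≢neg : ∀ {x} → (Literal V ∋ pos x) ≢ neg x
    pos≢neg ()

  -- Distinct premises, like distinct conclusions, make membership agree with multiplicity and give
  -- each clause of a rule its own neighbour.
  ins-unique : ∀ s → Unique (ins s)
  ins-unique (cut P C x)   = halves-unique P C x
  ins-unique (split P C x) = [] ∷ []

  outs-unique : ∀ s → Unique (outs s)
  outs-unique (cut P C x)   = [] ∷ []
  outs-unique (split P C x) = halves-unique P C x

  ruleOf : Step V → RuleInstance V
  ruleOf (cut P C x)   = cut (P ++ C) x
  ruleOf (split P C x) = split (P ++ C) x

  ≈-refl : {C : Clause V} → C ≈ C
  ≈-refl = mk⇔ id id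

  halves-≈ : ∀ P C x → Pointwise _≈_ (halves P C x) (((P ++ C) ∨ pos x) ∷ ((P ++ C) ∨ neg x) ∷ [])
  halves-≈ P C x = shift-≈ (pos x) ∷ shift-≈ (neg x) ∷ []
    where
    shift-≈ : ∀ l → P ++ l ∷ C ≈ (P ++ C) ∨ l
    shift-≈ l = bag-=⇒ (↭⇒∼bag (shift l P C))

  ins-≈ : ∀ s → Pointwise _≈_ (ins s) (premises (ruleOf s))
  ins-≈ (cut P C x)   = halves-≈ P C x
  ins-≈ (split P C x) = ≈-refl ∷ []

  outs-≈ : ∀ s → Pointwise _≈_ (outs s) (conclusions (ruleOf s))
  outs-≈ (cut P C x)   = ≈-refl ∷ []
  outs-≈ (split P C x) = halves-≈ P C x

  singles : List V → List (Clause V)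
  singles = map (λ x → [ neg x ])

  -- The entry for x is falsified iff P is and x is the last true variable of the list.
  fan : Clause V → List V → List (Clause V)
  fan P []       = []
  fan P (x ∷ xs) = (P ++ neg x ∷ map pos xs) ∷ fan P xs

-- Derivations between multisets of clauses

module LinearDerivations {V : Set} (_≟ⱽ_ : DecidableEquality V) (ℋ : ClauseSet V) where

  _≟ˡ_ : DecidableEquality (Literal V)
  pos x ≟ˡ pos y = map′ (cong pos) (λ { refl → refl }) (x ≟ⱽ y)
  pos x ≟ˡ neg y = no λ ()
  neg x ≟ˡ pos y = no λ ()
  neg x ≟ˡ neg y = map′ (cong neg) (λ { refl → refl }) (x ≟ⱽ y)

  _≟ᶜ_ : DecidableEquality (Clause V)
  _≟ᶜ_ = ≡-dec _≟ˡ_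

  open DecMembership _≟ᶜ_ using (_∈?_)

  occ : Clause V → List (Clause V) → ℕ
  occ C Γ = length (filter (C ≟ᶜ_) Γ)

  -- Each step counts at most once, since neighbourhoods in the graph are sets. For `outs` and `ins`
  -- this is the unit flow into and out of the vertex labelled `C`.
  tally : (Step V → List (Clause V)) → Clause V → List (Step V) → ℕ
  tally f C S = length (filter (λ s → C ∈? f s) S)

  occ-++ : ∀ C Γ Δ → occ C (Γ ++ Δ) ≡ occ C Γ + occ C Δ
  occ-++ C Γ Δ = trans (cong length (filter-++ (C ≟ᶜ_) Γ Δ)) (length-++ (filter (C ≟ᶜ_) Γ))

  tally-++ : ∀ f C S T → tally f C (S ++ T) ≡ tally f C S + tally f C T
  tally-++ f C S T =
    trans (cong length (filter-++ P? S T)) (length-++ (filter P? S))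
    where P? = λ s → C ∈? f s

  occ-∉ : ∀ {C} Γ → ¬ C ∈ Γ → occ C Γ ≡ 0
  occ-∉ []      C∉ = refl
  occ-∉ {C} (D ∷ Γ) C∉ =
    trans (cong length (filter-reject (C ≟ᶜ_) (C∉ ∘ here))) (occ-∉ Γ (C∉ ∘ there))

  occ-∈ : ∀ {C Γ} → Unique Γ → C ∈ Γ → occ C Γ ≡ 1
  occ-∈ {C} {D ∷ Γ} u (here refl) =
    trans (cong length (filter-accept (C ≟ᶜ_) refl)) (cong suc (occ-∉ Γ (Unique[x∷xs]⇒x∉xs u)))
  occ-∈ {C} {D ∷ Γ} u@(_ ∷ u′) (there C∈) =
    trans (cong length (filter-reject (C ≟ᶜ_) λ { refl → Unique[x∷xs]⇒x∉xs u C∈ })) (occ-∈ u′ C∈)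

  tally-[] : ∀ f C s → Unique (f s) → tally f C [ s ] ≡ occ C (f s)
  tally-[] f C s u with C ∈? f s
  ... | yes C∈ = sym (occ-∈ u C∈)
  ... | no C∉  = sym (occ-∉ (f s) C∉)

  infix 3 _⊢[_]_

  -- Only the balance of the steps counts, not their order, so derivations may be
  -- circular; clauses of ℋ are free and superfluous clauses may be left over.
  record _⊢[_]_ (Γ : List (Clause V)) (k : ℕ) (Δ : List (Clause V)) : Set where
    constructor derivation
    field
      steps    : List (Step V)
      bound    : length steps ≤ k
      balanced : ∀ C → C ∈ᶜ ℋ ⊎ tally ins C steps + occ C Δ ≤ tally outs C steps + occ C Γ

  open _⊢[_]_

  private variable
    Γ Γ′ Δ Δ′ Θ : List (Clause V)
    C : Clause V
    k l : ℕ

  weaken : k ≤ l → Γ ⊢[ k ] Δ → Γ ⊢[ l ] Δ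
  weaken k≤l (derivation S b e) = derivation S (≤-trans b k≤l) e

  permute : Γ ↭ Δ → Γ ⊢[ 0 ] Δ
  permute Γ↭Δ = derivation [] z≤n λ C →
    inj₂ (≤-reflexive (sym (↭-length (filter-↭ (C ≟ᶜ_) Γ↭Δ))))

  discard : ∀ Γ → Γ ⊢[ 0 ] []
  discard Γ = derivation [] z≤n λ C → inj₂ z≤n

  hypothesis : C ∈ᶜ ℋ → [] ⊢[ 0 ] [ C ]
  hypothesis {C} C∈ = derivation [] z≤n λ D → lemma D
    where
    lemma : ∀ D → D ∈ᶜ ℋ ⊎ occ D [ C ] ≤ 0
    lemma D with D ≟ᶜ C
    ... | yes refl = inj₁ C∈
    ... | no _     = inj₂ z≤n

  step : ∀ s → ins s ⊢[ 1 ] outs s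
  step s = derivation [ s ] ≤-refl λ C → inj₂ (≤-reflexive (begin
    tally ins C [ s ] + occ C (outs s)  ≡⟨ cong₂ _+_ (tally-[] ins C s (ins-unique s))
                                             (sym (tally-[] outs C s (outs-unique s))) ⟩
    occ C (ins s) + tally outs C [ s ]  ≡⟨ +-comm (occ C (ins s)) _ ⟩
    tally outs C [ s ] + occ C (ins s)  ∎))
    where open ≡-Reasoning

  -- Balances add up: the occurrences in `Δ` that the second derivation consumes are those that the
  -- first one supplies.
  then : Γ ⊢[ k ] Δ → Δ ⊢[ l ] Θ → Γ ⊢[ k + l ] Θ
  then {Γ} {k} {Δ} {l} {Θ} (derivation S bS eS) (derivation T bT eT) =
    derivation (S ++ T) (≤-trans (≤-reflexive (length-++ S)) (+-mono-≤ bS bT)) combine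
    where
    combine : ∀ C → C ∈ᶜ ℋ ⊎ tally ins C (S ++ T) + occ C Θ ≤ tally outs C (S ++ T) + occ C Γ
    combine C with eS C | eT C
    ... | inj₁ C∈ | _       = inj₁ C∈
    ... | inj₂ _  | inj₁ C∈ = inj₁ C∈
    ... | inj₂ p  | inj₂ q  = inj₂ (begin
      tally ins C (S ++ T) + t          ≡⟨ cong (_+ t) (tally-++ ins C S T) ⟩
      (iS + iT) + t                     ≡⟨ +-assoc iS iT t ⟩
      iS + (iT + t)                     ≤⟨ +-monoʳ-≤ iS q ⟩
      iS + (oT + d)                     ≡⟨ solve 3 (λ a b c → a :+ (b :+ c) := b :+ (a :+ c)) refl iS oT d ⟩
      oT + (iS + d)                     ≤⟨ +-monoʳ-≤ oT p ⟩
      oT + (oS + g)                     ≡⟨ solve 3 (λ a b c → a :+ (b :+ c) := (b :+ a) :+ c) refl oT oS g ⟩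
      (oS + oT) + g                     ≡⟨ cong (_+ g) (tally-++ outs C S T) ⟨
      tally outs C (S ++ T) + g         ∎)
      where
      open ≤-Reasoning
      iS = tally ins C S
      iT = tally ins C T
      oS = tally outs C S
      oT = tally outs C T
      g  = occ C Γ
      d  = occ C Δ
      t  = occ C Θ

  frame : ∀ Θ → Γ ⊢[ k ] Δ → Γ ++ Θ ⊢[ k ] Δ ++ Θ
  frame {Γ} {k} {Δ} Θ (derivation S b e) = derivation S b add
    where
    add : ∀ C → C ∈ᶜ ℋ ⊎ tally ins C S + occ C (Δ ++ Θ) ≤ tally outs C S + occ C (Γ ++ Θ)
    add C with e C
    ... | inj₁ C∈ = inj₁ C∈
    ... | inj₂ p  = inj₂ (subst₂ _≤_ (reassoc (tally ins C S) Δ) (reassoc (tally outs C S) Γ)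
                            (+-monoˡ-≤ (occ C Θ) p))
      where
      reassoc : ∀ a Γ → (a + occ C Γ) + occ C Θ ≡ a + occ C (Γ ++ Θ)
      reassoc a Γ = trans (+-assoc a _ _) (cong (a +_) (sym (occ-++ C Γ Θ)))

  frameˡ : ∀ Θ → Γ ⊢[ k ] Δ → Θ ++ Γ ⊢[ k ] Θ ++ Δ
  frameˡ {Γ} {k} {Δ} Θ d = weaken (≤-reflexive (+-identityʳ k))
    (then (permute (++-comm Θ Γ)) (then (frame Θ d) (permute (++-comm Δ Θ))))
  
  par : Γ ⊢[ k ] Δ → Γ′ ⊢[ l ] Δ′ → Γ ++ Γ′ ⊢[ k + l ] Δ ++ Δ′
  par {Γ} {k} {Δ} {Γ′} d d′ = then (frame Γ′ d) (frameˡ Δ d′)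

  parAll : ∀ {A : Set} {f g : A → List (Clause V)} → (∀ a → f a ⊢[ k ] g a) →
           ∀ as → concatMap f as ⊢[ length as * k ] concatMap g as
  parAll d []       = permute ↭.refl
  parAll d (a ∷ as) = par (d a) (parAll d as)

  -- Splitting and reassembling clauses along a list of variables

  -- The splits run from the last variable to the first, each splitting the clause whose later
  -- variables are all positive. Writing `P ++ []` makes the base case hold definitionally.
  dissect : ∀ P xs → [ P ++ [] ] ⊢[ length xs ] (P ++ map pos xs) ∷ fan P xs
  dissect P []       = permute ↭.refl
  dissect P (x ∷ xs) = weaken (≤-reflexive (+-comm (length xs) 1))
    (then (dissect P xs) (frame (fan P xs) (step (split P (map pos xs) x))))

  -- Weakening by positive literals, obtained from splits by dropping the other halves.
  dissect-first : ∀ P xs → [ P ++ [] ] ⊢[ length xs ] [ P ++ map pos xs ]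
  dissect-first P xs = weaken (≤-reflexive (+-identityʳ (length xs)))
    (then (dissect P xs) (frameˡ [ _ ] (discard (fan P xs))))

  -- The inverse of `dissect`: cuts remove the variables from the first to the last.
  assemble : ∀ P xs → (P ++ map pos xs) ∷ fan P xs ⊢[ length xs ] [ P ++ [] ]
  assemble P []       = permute ↭.refl
  assemble P (x ∷ xs) = then (frame (fan P xs) (step (cut P (map pos xs) x))) (assemble P xs)

  -- The entry for `y` is the hypothesis on `x` and `y` weakened by the variables after `y`.
  hypotheses⇒fan : ∀ x xs → All (λ y → (neg x ∷ neg y ∷ []) ∈ᶜ ℋ) xs →
                   [] ⊢[ length xs * length xs ] fan [ neg x ] xs
  hypotheses⇒fan x []       []       = permute ↭.refl
  hypotheses⇒fan x (y ∷ ys) (h ∷ hs) = weaken (m+m²≤[1+m]² (length ys))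
    (par (then (hypothesis h) (dissect-first (neg x ∷ neg y ∷ []) ys))
         (hypotheses⇒fan x ys hs))

  fan⇒singles : ∀ xs → AllPairs (λ x y → (neg x ∷ neg y ∷ []) ∈ᶜ ℋ) xs →
                fan [] xs ⊢[ length xs * (length xs * length xs) ] singles xs
  fan⇒singles []       []       = permute ↭.refl
  fan⇒singles (x ∷ xs) (h ∷ hs) = weaken (m²+m+m³≤[1+m]³ (length xs))
    -- The first entry of the fan says that `x` is false or some later variable is true. The
    -- weakened hypotheses supply the fan under `neg x`, and assembling both leaves the unit clause.
    (par (then (frameˡ [ _ ] (hypotheses⇒fan x xs h)) (assemble [ neg x ] xs))
         (fan⇒singles xs hs))

  -- Each entry is a weakening of the unit clause for its variable.
  singles⇒fan : ∀ xs → singles xs ⊢[ length xs * length xs ] fan [] xs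
  singles⇒fan []       = permute ↭.refl
  singles⇒fan (x ∷ xs) = weaken (m+m²≤[1+m]² (length xs))
    (par (dissect-first [ neg x ] xs) (singles⇒fan xs))

  empty⇒singles : ∀ xs → AllPairs (λ x y → (neg x ∷ neg y ∷ []) ∈ᶜ ℋ) xs →
                  [ 𝟘 ] ⊢[ length xs + length xs * (length xs * length xs) ] singles xs
  empty⇒singles xs hs =
    -- The discarded clause is the all-positive one, false only when no variable of the list is
    -- true.
    then (dissect [] xs) (then (frame (fan [] xs) (discard [ _ ])) (fan⇒singles xs hs))

  singles⇒empty : ∀ xs → map pos xs ∈ᶜ ℋ →
                  singles xs ⊢[ length xs * length xs + length xs ] [ 𝟘 ]
  singles⇒empty xs h =
    -- The all-positive clause missing from the fan is the hypothesis itself.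
    then (singles⇒fan xs) (then (frame (fan [] xs) (hypothesis h)) (assemble [] xs))

  -- From balanced derivations to circular proofs

  module _ (L : List (Clause V)) where

    -- Neighbourhoods are found by label, which is unambiguous once the labels in `L` are pairwise
    -- distinct.
    having : List (Clause V) → Subset (length L)
    having Γ = Vec.tabulate λ u → does (lookup L u ∈? Γ)

    ∈-having : ∀ Γ u → u ∈ₛ having Γ ⇔ lookup L u ∈ Γ
    ∈-having Γ u = mk⇔
      (λ u∈ → from-does (trans (sym (Vec.lookup∘tabulate _ u)) (Vec.[]=⇒lookup u∈)))
      (λ C∈ → Vec.lookup⇒[]= u (having Γ) (trans (Vec.lookup∘tabulate _ u) (dec-true (_ ∈? Γ) C∈)))
      where
      from-does : does (lookup L u ∈? Γ) ≡ true → lookup L u ∈ Γ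
      from-does eq with lookup L u ∈? Γ
      from-does eq | yes C∈ = C∈
      from-does () | no _

    indices : All (_∈ L) Γ → List (Fin (length L))
    indices []       = []
    indices (p ∷ ps) = index p ∷ indices ps

    map-lookup-indices : (ps : All (_∈ L) Γ) → map (lookup L) (indices ps) ≡ Γ
    map-lookup-indices []       = refl
    map-lookup-indices (p ∷ ps) = cong₂ _∷_ (sym (lookup-index p)) (map-lookup-indices ps)

    having-matches : Unique L → Unique Γ → All (_∈ L) Γ → Pointwise _≈_ Γ Δ →
                     Matches (lookup L) (having Γ) Δ
    having-matches {Γ} {Δ} L! Γ! Γ⊆L Γ≈Δ =
      indices Γ⊆L ,
      Unique-map⁻ (subst Unique (sym (map-lookup-indices Γ⊆L)) Γ!) ,
      (λ u → mk⇔ (∈-indices ∘ Equivalence.to (∈-having Γ u))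
                 (Equivalence.from (∈-having Γ u) ∘ indices-∈)) ,
      labels-≈ Γ⊆L Γ≈Δ
      where
      indices-∈ : ∀ {u} → u ∈ indices Γ⊆L → lookup L u ∈ Γ
      indices-∈ {u} = subst (lookup L u ∈_) (map-lookup-indices Γ⊆L) ∘ ∈-map⁺ (lookup L)

      ∈-indices : ∀ {u} → lookup L u ∈ Γ → u ∈ indices Γ⊆L
      ∈-indices {u} C∈
        with ∈-map⁻ (lookup L) (subst (lookup L u ∈_) (sym (map-lookup-indices Γ⊆L)) C∈)
      -- Only equality of labels is known here; uniqueness of `L` turns it into equality of
      -- vertices.
      ... | v , v∈ , eq = subst (_∈ indices Γ⊆L) (sym (lookup-injective L! u v eq)) v∈

      labels-≈ : ∀ {Γ Δ} (ps : All (_∈ L) Γ) → Pointwise _≈_ Γ Δ →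
                 Pointwise (λ u C → lookup L u ≈ C) (indices ps) Δ
      labels-≈ []       []         = []
      labels-≈ {Δ = D ∷ _} (p ∷ ps) (C≈D ∷ ≈s) = subst (_≈ D) (lookup-index p) C≈D ∷ labels-≈ ps ≈s

  module _ (S : List (Step V)) where

    ends : Step V → List (Clause V)
    ends s = ins s ++ outs s

    -- Deduplication merges all occurrences of a clause into one vertex, so that the balance of this
    -- vertex is the total surplus of the clause.
    clauses : List (Clause V)
    clauses = deduplicate _≟ᶜ_ (concatMap ends S)

    clauses-unique : Unique clauses
    clauses-unique = UniqueDec.deduplicate-! _≟ᶜ_ (concatMap ends S)

    ends⊆clauses : ∀ w {C} → C ∈ ends (lookup S w) → C ∈ clauses
    ends⊆clauses w C∈ =
      ∈-deduplicate⁺ _≟ᶜ_ (∈-concatMap⁺ ends (Any.map (λ { refl → C∈ }) (∈-lookup {xs = S} w)))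

    length-clauses : length clauses ≤ 3 * length S
    length-clauses = ≤-trans (length-deduplicate _≟ᶜ_ (concatMap ends S)) (≤-reflexive (go S))
      where
      length-ends : ∀ s → length (ends s) ≡ 3
      length-ends (cut P C x)   = refl
      length-ends (split P C x) = refl

      go : ∀ S → length (concatMap ends S) ≡ 3 * length S
      go []      = refl
      go (s ∷ S) = trans (length-++ (ends s))
        (trans (cong₂ _+_ (length-ends s) (go S)) (sym (*-suc 3 (length S))))

    graph : PreProof V
    graph = record
      { #J         = length clauses
      ; #I         = length S
      ; inNbrs     = λ w → having clauses (ins (lookup S w))
      ; outNbrs    = λ w → having clauses (outs (lookup S w))
      ; label      = lookup clauses
      ; rule       = λ w → ruleOf (lookup S w)
      ; inMatches  = λ w → having-matches clauses clauses-unique (ins-unique (lookup S w))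
                       (All.tabulate (ends⊆clauses w ∘ ∈-++⁺ˡ)) (ins-≈ (lookup S w))
      ; outMatches = λ w → having-matches clauses clauses-unique (outs-unique (lookup S w))
                       (All.tabulate (ends⊆clauses w ∘ ∈-++⁺ʳ (ins (lookup S w)))) (outs-≈ (lookup S w))
      }

    open PreProof graph using (N⁻; N⁺)

    length-N⁻ : ∀ u → length (N⁻ u) ≡ tally outs (lookup clauses u) S
    length-N⁻ u = length-filter-allFin S _ _ λ w → ∈-having clauses (outs (lookup S w)) u

    length-N⁺ : ∀ u → length (N⁺ u) ≡ tally ins (lookup clauses u) S
    length-N⁺ u = length-filter-allFin S _ _ λ w → ∈-having clauses (ins (lookup S w)) u

  tally>0⇒∈ : ∀ f C S → 0 < tally f C S → Any (λ s → C ∈ f s) S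
  tally>0⇒∈ f C (s ∷ S) p with C ∈? f s
  ... | yes C∈ = here C∈
  ... | no _   = there (tally>0⇒∈ f C S p)

  -- Feeding the copy of Γ among the conclusions back into the premises closes the circle.
  circular-refutation : ¬ 𝟘 ∈ᶜ ℋ → Γ ⊢[ k ] 𝟘 ∷ Γ →
                        Σ[ Π ∈ PreProof V ] (IsRefutation Π ℋ × proofLength Π ≤ 4 * k)
  circular-refutation {Γ} {k} 𝟘∉ (derivation S b e) =
    -- The factor 4 counts one inference-vertex and at most three formula-vertices per step.
    graph S , (unitFlow , sources , 𝟘-vertex , sink 𝟘-vertex 𝟘-gains , label-𝟘) , (begin
      length (clauses S) + length S  ≤⟨ +-monoˡ-≤ (length S) (length-clauses S) ⟩
      3 * length S + length S        ≡⟨ +-comm (3 * length S) (length S) ⟩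
      4 * length S                   ≤⟨ *-monoʳ-≤ 4 b ⟩
      4 * k                          ∎)
    where
    open ≤-Reasoning
    open UnitFlow (graph S)
    open PreProof (graph S) using (J; N⁻; N⁺; IsSource; label)

    surplus : ∀ C → C ∈ᶜ ℋ ⊎ tally ins C S + occ C [ 𝟘 ] ≤ tally outs C S
    surplus C with e C
    ... | inj₁ C∈ = inj₁ C∈
    -- `Γ` occurs on both sides and cancels, leaving the extra copy of `𝟘` as pure surplus.
    ... | inj₂ p  = inj₂ (+-cancelʳ-≤ (occ C Γ) _ _ (subst (_≤ tally outs C S + occ C Γ)
            (trans (cong (tally ins C S +_) (occ-++ C [ 𝟘 ] Γ)) (sym (+-assoc (tally ins C S) _ _))) p))

    sources : ∀ u → IsSource unitFlow u → label u ∈ᶜ ℋ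
    sources u src with surplus (label u)
    ... | inj₁ C∈ = C∈
    ... | inj₂ p  = contradiction src (not-source u
            (subst₂ _≤_ (sym (length-N⁺ S u)) (sym (length-N⁻ S u)) (≤-trans (m≤m+n _ _) p)))

    𝟘-surplus : tally ins 𝟘 S < tally outs 𝟘 S
    𝟘-surplus with surplus 𝟘
    -- Clauses of `ℋ` are exempt from balancing, so the surplus of `𝟘` is guaranteed because `𝟘` is
    -- not one of them.
    ... | inj₁ 𝟘∈ = contradiction 𝟘∈ 𝟘∉
    ... | inj₂ p  = subst (_≤ tally outs 𝟘 S) (+-comm (tally ins 𝟘 S) 1) p

    𝟘∈clauses : 𝟘 ∈ clauses S
    𝟘∈clauses = ∈-deduplicate⁺ _≟ᶜ_ (∈-concatMap⁺ (ends S)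
      (Any.map (λ {s} → ∈-++⁺ʳ (ins s)) (tally>0⇒∈ outs 𝟘 S (≤-<-trans z≤n 𝟘-surplus))))

    𝟘-vertex : J
    𝟘-vertex = index 𝟘∈clauses

    label-𝟘 : label 𝟘-vertex ≈ 𝟘
    label-𝟘 = subst (_≈ 𝟘) (lookup-index 𝟘∈clauses) ≈-refl

    𝟘-gains : length (N⁺ 𝟘-vertex) < length (N⁻ 𝟘-vertex)
    𝟘-gains = subst₂ _<_ (sym (length-N⁺ S 𝟘-vertex)) (sym (length-N⁻ S 𝟘-vertex))
      (subst (λ C → tally ins C S < tally outs C S) (lookup-index 𝟘∈clauses) 𝟘-surplus)

-- The pigeonhole formula

_≟ₓ_ : ∀ {n} → DecidableEquality (PHPVar n)
X u v ≟ₓ X u′ v′ with u Fin.≟ u′ | v Fin.≟ v′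
... | yes refl | yes refl = yes refl
... | no u≢    | _        = no λ { refl → u≢ refl }
... | _        | no v≢    = no λ { refl → v≢ refl }

module _ (n : ℕ) where

  open LinearDerivations (_≟ₓ_ {n}) (PHP n)

  pigeonVars : Fin (suc n) → List (PHPVar n)
  pigeonVars u = map (X u) (allFin n)

  holeVars : Fin n → List (PHPVar n)
  holeVars v = map (λ u → X u v) (allFin (suc n))

  axiom-∈ᶜ : ∀ {C} → PHP n C → C ∈ᶜ PHP n
  axiom-∈ᶜ h = _ , h , ≈-refl

  hole-hypotheses : ∀ v → AllPairs (λ x y → (neg x ∷ neg y ∷ []) ∈ᶜ PHP n) (holeVars v)
  hole-hypotheses v = AllPairsₚ.map⁺
    -- `_∨_` adds literals at the front, so the list form of a hole clause starts with its second
    -- pigeon; hence the reversed inequality.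
    (AllPairs.map (λ u≢u′ → axiom-∈ᶜ (hole (u≢u′ ∘ sym) v)) (allFin⁺ (suc n)))

  pigeon-hypothesis : ∀ u → map pos (pigeonVars u) ∈ᶜ PHP n
  pigeon-hypothesis u = subst (_∈ᶜ PHP n) (map-∘ (allFin n)) (axiom-∈ᶜ (pigeon u))

  𝟘∉PHP : 1 ≤ n → ¬ 𝟘 ∈ᶜ PHP n
  -- With at least one hole, a pigeon clause has a first literal, which cannot lie in `𝟘`.
  𝟘∉PHP (s≤s _) (_ , pigeon u , eq) with () ← Equivalence.from eq (here refl)
  𝟘∉PHP _       (_ , hole _ v , eq) with () ← Equivalence.from eq (here refl)

  length-pigeonVars : ∀ u → length (pigeonVars u) ≡ n
  length-pigeonVars u = trans (length-map (X u) (allFin n)) (length-tabulate id)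

  length-holeVars : ∀ v → length (holeVars v) ≡ suc n
  length-holeVars v = trans (length-map (λ u → X u v) (allFin (suc n))) (length-tabulate {n = suc n} id)

  holeCost pigeonCost : ℕ
  holeCost   = suc n + suc n * (suc n * suc n)
  pigeonCost = n * n + n

  by-holes : replicate n 𝟘 ⊢[ n * holeCost ] concatMap (singles ∘ holeVars) (allFin n)
  by-holes = subst₂ (λ Γ k → Γ ⊢[ k ] concatMap (singles ∘ holeVars) (allFin n))
    (trans (concatMap-[-] 𝟘 (allFin n)) (cong (λ m → replicate m 𝟘) (length-tabulate {n = n} id)))
    (cong (_* holeCost) (length-tabulate {n = n} id))
    (parAll (λ v → subst (λ m → [ 𝟘 ] ⊢[ m + m * (m * m) ] singles (holeVars v))
                     (length-holeVars v) (empty⇒singles (holeVars v) (hole-hypotheses v)))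
            (allFin n))

  by-pigeons : concatMap (singles ∘ pigeonVars) (allFin (suc n)) ⊢[ suc n * pigeonCost ] replicate (suc n) 𝟘
  by-pigeons = subst₂ (λ Δ k → concatMap (singles ∘ pigeonVars) (allFin (suc n)) ⊢[ k ] Δ)
    (trans (concatMap-[-] 𝟘 (allFin (suc n)))
           (cong (λ m → replicate m 𝟘) (length-tabulate {n = suc n} id)))
    (cong (_* pigeonCost) (length-tabulate {n = suc n} id))
    (parAll (λ u → subst (λ m → singles (pigeonVars u) ⊢[ m * m + m ] [ 𝟘 ]) (length-pigeonVars u)
                     (singles⇒empty (pigeonVars u) (pigeon-hypothesis u)))
            (allFin (suc n)))

  -- Both sides list every negated variable exactly once, the left by holes and the right by
  -- pigeons.
  transpose-singles : concatMap (singles ∘ holeVars) (allFin n) ↭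
                      concatMap (singles ∘ pigeonVars) (allFin (suc n))
  transpose-singles = subst₂ _↭_
    (concatMap-cong (λ v → map-∘ (allFin (suc n))) (allFin n))
    (concatMap-cong (λ u → map-∘ (allFin n)) (allFin (suc n)))
    (transpose-↭ (λ v u → [ neg (X u v) ]) (allFin n) (allFin (suc n)))

  one-more-𝟘 : replicate n 𝟘 ⊢[ n * holeCost + suc n * pigeonCost ] 𝟘 ∷ replicate n 𝟘
  one-more-𝟘 = then by-holes (then (permute transpose-singles) by-pigeons)

  PHP-refutation : 1 ≤ n → Σ[ Π ∈ PreProof (PHPVar n) ] (IsRefutation Π (PHP n) ×
    proofLength Π ≤ 4 * (n * holeCost + suc n * pigeonCost))
  PHP-refutation 1≤n = circular-refutation (𝟘∉PHP 1≤n) one-more-𝟘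

corollary1 : Σ[ p ∈ Polynomial ] ((n : ℕ) → 1 ≤ n →
    Σ[ Π ∈ PreProof (PHPVar n) ] (IsRefutation Π (PHP n) × proofLength Π ≤ eval p n))
-- The polynomial is the fourfold cost of `one-more-𝟘` multiplied out; `n` holes of cubic cost make
-- its degree 4.
corollary1 = 0 ∷ 12 ∷ 24 ∷ 16 ∷ 4 ∷ [] , λ n 1≤n →
  let Π , refutes , short = PHP-refutation n 1≤n
  in Π , refutes , ≤-trans short (≤-reflexive (expand n))
  where
  expand : ∀ n → 4 * (n * (suc n + suc n * (suc n * suc n)) + suc n * (n * n + n))
                 ≡ eval (0 ∷ 12 ∷ 24 ∷ 16 ∷ 4 ∷ []) n
  expand = solve 1 (λ n → let m = con 1 :+ n in
    con 4 :* (n :* (m :+ m :* (m :* m)) :+ m :* (n :* n :+ n))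
    := con 0 :+ n :* (con 12 :+ n :* (con 24 :+ n :* (con 16 :+ n :* (con 4 :+ n :* con 0))))) refl
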